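{- Let $L$ be a loop of order $n$ with underlying set $I_n=\{1,2,\ldots,n\}$, whose product of $x$ and $y$ is written $xy$, and let $c$ be any non-identity element of $L$. Let $\Gamma_4$ be the digraph with vertex set $I_n\times I_n\times\mathbb{Z}_3$ whose darts (arcs) are exactly the following: \begin{itemize} \item $(x,y,i)\mapsto(z,y,i)$ for all $i\in\mathbb{Z}_3$, $x,y,z\in I_n$, $x\neq z$; \item $(x,y,i)\mapsto(x,z,i)$ for all $i\in\mathbb{Z}_3$, $x,y,z\in I_n$, $y\neq z$; \item $(x,y,i)\mapsto(xy,z,i+1)$ for all $i\in\mathbb{Z}_3$, $x,y,z\in I_n$; \item $(x,y,i)\mapsto(z,yx,i-1)$ for all $i\in\mathbb{Z}_3$, $x,y,z\in I_n$; \item $(x,y,i)\mapsto(c(xy),z,i+1)$ for all $i\in\mathbb{Z}_3$, $x,y,z\in I_n$; \item $(x,y,i)\mapsto(z,(yx)c,i-1)$ for all $i\in\mathbb{Z}_3$, $x,y,z\in I_n$. \end{itemize} Then $\Gamma_4$ is a directed strongly regular graph with parameter set $(3n^2,\,6n-2,\,2n+6,\,n+6,\,10)$.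
   Context: A quasigroup is a set $Q$ with a binary operation such that for all $a,b\in Q$ each of the equations $ax=b$ and $ya=b$ has a unique solution in $Q$. A loop is a quasigroup with an identity element $e$, i.e. $ex=xe=x$ for every $x$. Associativity is not assumed. A directed strongly regular graph (DSRG) with parameter set $(N,k,t,\lambda,\mu)$ (in this order) is a loopless directed graph on $N$ vertices that is regular of valency $k$ (every vertex has in-degree and out-degree $k$), such that every vertex is incident with exactly $t$ undirected edges (an undirected edge is a pair of opposite arcs), and for any two distinct vertices $x,y$ the number of directed paths of length 2 from $x$ to $y$ is $\lambda$ if there is an arc from $x$ to $y$ and $\mu$ otherwise. Equivalently, its adjacency matrix $A$ (with zero diagonal) satisfies $AJ=JA=kJ$ and $A^2=tI+\lambda A+\mu(J-I-A)$, where $J$ is the all-one matrix and $I$ the identity matrix. The case $t=k$ (an undirected strongly regular graph) is allowed in this definition. -}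

module Defs where

open import Algebra.Core using (Op₂)
open import Data.Fin.Base using (Fin; toℕ)
open import Data.Fin.Properties using (_≟_; *↔×)
open import Data.List.Base using (List; allFin; filter; length; map)
open import Data.Nat.Base using (ℕ; _+_; _*_)
open import Data.Nat.DivMod using (_mod_)
open import Data.Product.Base using (_×_; _,_)
open import Data.Product.Function.NonDependent.Propositional using (_×-↔_)
open import Data.Sum.Base using (_⊎_; inj₁; inj₂)
open import Function.Bundles using (_↔_; module Inverse)
open import Function.Construct.Composition using (_↔-∘_)
open import Function.Construct.Identity using (↔-id)
open import Function.Construct.Symmetry using (↔-sym)
open import Level using (0ℓ)
open import Relation.Binary.Core using (Rel)
import Relation.Binary.Definitions as Binary
open import Relation.Binary.PropositionalEquality.Core using (_≡_; _≢_; refl)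
open import Relation.Nullary.Decidable using (map′; _×-dec_; _⊎-dec_; ¬?)
open import Relation.Nullary.Negation using (¬_)
open import Relation.Unary using (Pred; Decidable)

-- Arcs form a relation: at most one arc per ordered pair, so only the
-- inhabitation of x ⟶ y matters, not its number of proofs.
record Digraph : Set₁ where
  infix 4 _⟶_ _⟶?_
  field
    Vertex : Set
    order  : ℕ
    enum   : Vertex ↔ Fin order
    _⟶_    : Rel Vertex 0ℓ
    _⟶?_   : Binary.Decidable _⟶_

  vertices : List Vertex
  vertices = map (Inverse.from enum) (allFin order)

  count : {P : Pred Vertex 0ℓ} → Decidable P → ℕ
  count P? = length (filter P? vertices)

  outDegree : Vertex → ℕ
  outDegree x = count (λ y → x ⟶? y)

  inDegree : Vertex → ℕ
  inDegree x = count (λ y → y ⟶? x)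

  undirectedDegree : Vertex → ℕ
  undirectedDegree x = count (λ y → (x ⟶? y) ×-dec (y ⟶? x))

  -- Counted by the middle vertex.
  paths₂ : Vertex → Vertex → ℕ
  paths₂ x y = count (λ w → (x ⟶? w) ×-dec (w ⟶? y))

-- t = k (the undirected case) is not excluded.
record IsDSRG (G : Digraph) (N k t lam mu : ℕ) : Set where
  open Digraph G
  field
    order≡N            : order ≡ N
    loopless           : ∀ x → ¬ (x ⟶ x)
    outDegree≡k        : ∀ x → outDegree x ≡ k
    inDegree≡k         : ∀ x → inDegree x ≡ k
    undirectedDegree≡t : ∀ x → undirectedDegree x ≡ t
    adjacent           : ∀ x y → x ≢ y → x ⟶ y → paths₂ x y ≡ lam
    nonadjacent        : ∀ x y → x ≢ y → ¬ (x ⟶ y) → paths₂ x y ≡ mu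

ℤ₃ : Set
ℤ₃ = Fin 3

infix 8 _⁺ _⁻

_⁺ : ℤ₃ → ℤ₃
i ⁺ = (toℕ i + 1) mod 3

-- 2 represents -1 modulo 3.
_⁻ : ℤ₃ → ℤ₃
i ⁻ = (toℕ i + 2) mod 3

-- I_n is Fin n; the underlying set is 0-based here.
module _ {n : ℕ} (_∙_ : Op₂ (Fin n)) (c : Fin n) where

  Vertex₄ : Set
  Vertex₄ = Fin n × Fin n × ℤ₃

  data Arc₄ : Rel Vertex₄ 0ℓ where
    change-fst : ∀ {x y z i} → x ≢ z → Arc₄ (x , y , i) (z , y , i)
    change-snd : ∀ {x y z i} → y ≢ z → Arc₄ (x , y , i) (x , z , i)
    up         : ∀ {x y z i} → Arc₄ (x , y , i) (x ∙ y , z , i ⁺)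
    down       : ∀ {x y z i} → Arc₄ (x , y , i) (z , y ∙ x , i ⁻)
    up-c       : ∀ {x y z i} → Arc₄ (x , y , i) (c ∙ (x ∙ y) , z , i ⁺)
    down-c     : ∀ {x y z i} → Arc₄ (x , y , i) (z , (y ∙ x) ∙ c , i ⁻)

  arc₄? : Binary.Decidable Arc₄
  arc₄? (x , y , i) (x′ , y′ , i′) = map′ to from
    (     ¬? (x ≟ x′) ×-dec (y′ ≟ y) ×-dec (i′ ≟ i)
    ⊎-dec ¬? (y ≟ y′) ×-dec (x′ ≟ x) ×-dec (i′ ≟ i)
    ⊎-dec (x′ ≟ x ∙ y) ×-dec (i′ ≟ i ⁺)
    ⊎-dec (y′ ≟ y ∙ x) ×-dec (i′ ≟ i ⁻)
    ⊎-dec (x′ ≟ c ∙ (x ∙ y)) ×-dec (i′ ≟ i ⁺)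
    ⊎-dec (y′ ≟ (y ∙ x) ∙ c) ×-dec (i′ ≟ i ⁻))
    where
    Cases : Set
    Cases = (x ≢ x′ × y′ ≡ y × i′ ≡ i)
          ⊎ (y ≢ y′ × x′ ≡ x × i′ ≡ i)
          ⊎ (x′ ≡ x ∙ y × i′ ≡ i ⁺)
          ⊎ (y′ ≡ y ∙ x × i′ ≡ i ⁻)
          ⊎ (x′ ≡ c ∙ (x ∙ y) × i′ ≡ i ⁺)
          ⊎ (y′ ≡ (y ∙ x) ∙ c × i′ ≡ i ⁻)

    to : Cases → Arc₄ (x , y , i) (x′ , y′ , i′)
    to (inj₁ (p , refl , refl)) = change-fst p
    to (inj₂ (inj₁ (p , refl , refl))) = change-snd p
    to (inj₂ (inj₂ (inj₁ (refl , refl)))) = up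
    to (inj₂ (inj₂ (inj₂ (inj₁ (refl , refl))))) = down
    to (inj₂ (inj₂ (inj₂ (inj₂ (inj₁ (refl , refl)))))) = up-c
    to (inj₂ (inj₂ (inj₂ (inj₂ (inj₂ (refl , refl)))))) = down-c

    from : Arc₄ (x , y , i) (x′ , y′ , i′) → Cases
    from (change-fst p) = inj₁ (p , refl , refl)
    from (change-snd p) = inj₂ (inj₁ (p , refl , refl))
    from up = inj₂ (inj₂ (inj₁ (refl , refl)))
    from down = inj₂ (inj₂ (inj₂ (inj₁ (refl , refl))))
    from up-c = inj₂ (inj₂ (inj₂ (inj₂ (inj₁ (refl , refl)))))
    from down-c = inj₂ (inj₂ (inj₂ (inj₂ (inj₂ (refl , refl)))))

  Γ₄ : Digraph
  Γ₄ = record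
    { Vertex = Vertex₄
    ; order  = n * (n * 3)
    ; enum   = ↔-sym ((↔-id (Fin n) ×-↔ *↔×) ↔-∘ *↔×)
    ; _⟶_    = Arc₄
    ; _⟶?_   = arc₄?
    }

{-# OPTIONS --safe #-}
-- With A the adjacency matrix, every row of B = A + 2I is a sum of six
-- indicators of "lines", where a line fixes the layer i and one of the first
-- two coordinates: two lines in each of the three layers.  Summing the rows of
-- B over the points of a line ℓ in layer i gives n times the indicator of ℓ,
-- plus 1 on layer i and 2 on the two other layers, because left and right
-- translations are bijective.  Hence B² = nB + 10J, i.e.
-- A² + 4A + 4I = n(A + 2I) + 10J, from which all parameters are read off.
module Submission where

open import Defs
open import Algebra.Bundles using (Loop)
open import Algebra.Core using (Op₂)
import Algebra.Properties.Loop as LoopProperties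
import Algebra.Properties.Semiring.Sum as SemiringSum
open import Algebra.Structures using (IsLoop)
open import Data.Bool.Base using (if_then_else_; true; false)
open import Data.Fin.Base using (Fin; zero; suc; _↑ˡ_; _↑ʳ_; combine; remQuot)
open import Data.Fin.Patterns using (0F; 1F; 2F)
open import Data.Fin.Permutation using (Permutation′; _⟨$⟩ʳ_) renaming (id to idₚ)
open import Data.Fin.Properties using (_≟_; remQuot-combine)
open import Data.List.Base using (filter; length; map; tabulate)
open import Data.Nat.Base using (ℕ; zero; suc; _+_; _*_; _∸_; _^_)
open import Data.Nat.Properties using (+-assoc; +-cancelʳ-≡; +-comm; +-identityʳ; *-assoc; *-comm;
  *-identityˡ; *-identityʳ; +-*-semiring; m+n∸n≡m)
open import Data.Nat.Tactic.RingSolver using (solve-∀)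
open import Data.Product.Base using (_×_; _,_; proj₁; proj₂)
open import Data.Sum.Base using (_⊎_; inj₁; inj₂)
open import Function.Base using (_∘_; id)
open import Function.Bundles using (mk↔ₛ′; module Inverse)
open import Function.Construct.Composition using (_↔-∘_)
open import Relation.Binary.PropositionalEquality
open import Relation.Nullary.Decidable using (Dec; does; yes; no; _×-dec_; _⊎-dec_; ¬?)
open import Relation.Nullary.Negation using (¬_; contradiction)
open import Relation.Unary using (Pred; Decidable)

open SemiringSum +-*-semiring
open ≡-Reasoning

private
  variable
    m n : ℕ
    P Q : Set

-- Indicators of decidable propositions.

𝟙 : Dec P → ℕ
𝟙 P? = if does P? then 1 else 0

𝟙-true : (P? : Dec P) → P → 𝟙 P? ≡ 1
𝟙-true (yes _) _ = refl
𝟙-true (no ¬p) p = contradiction p ¬p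

𝟙-false : (P? : Dec P) → ¬ P → 𝟙 P? ≡ 0
𝟙-false (yes p) ¬p = contradiction p ¬p
𝟙-false (no _)  _  = refl

𝟙-cong : (P? : Dec P) (Q? : Dec Q) → (P → Q) → (Q → P) → 𝟙 P? ≡ 𝟙 Q?
𝟙-cong (yes p) Q? f _ = sym (𝟙-true Q? (f p))
𝟙-cong (no ¬p) Q? _ g = sym (𝟙-false Q? (¬p ∘ g))

𝟙-× : (P? : Dec P) (Q? : Dec Q) → 𝟙 (P? ×-dec Q?) ≡ 𝟙 P? * 𝟙 Q?
𝟙-× (yes _) Q? = sym (*-identityˡ (𝟙 Q?))
𝟙-× (no _)  Q? = refl

𝟙-⊎ : (P? : Dec P) (Q? : Dec Q) → (P → ¬ Q) → 𝟙 (P? ⊎-dec Q?) ≡ 𝟙 P? + 𝟙 Q?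
𝟙-⊎ (yes p) Q? disjoint = cong suc (sym (𝟙-false Q? (disjoint p)))
𝟙-⊎ (no _)  Q? _        = refl

𝟙-¬ : (P? : Dec P) → 𝟙 (¬? P?) + 𝟙 P? ≡ 1
𝟙-¬ (yes _) = refl
𝟙-¬ (no _)  = refl

-- Kronecker deltas and finite sums.

δ : Fin n → Fin n → ℕ
δ x y = 𝟙 (x ≟ y)

δ-refl : (x : Fin n) → δ x x ≡ 1
δ-refl x = 𝟙-true (x ≟ x) refl

δ-sym : (x y : Fin n) → δ x y ≡ δ y x
δ-sym x y = 𝟙-cong (x ≟ y) (y ≟ x) sym sym

∑-const : ∀ n x → ∑[ i < n ] x ≡ n * x
∑-const zero    x = refl
∑-const (suc n) x = cong (x +_) (∑-const n x)

∑-δ : (a : Fin n) (f : Fin n → ℕ) → ∑[ k < n ] (δ k a * f k) ≡ f a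
∑-δ {suc n} zero f = begin
  1 * f zero + ∑[ k < n ] 0  ≡⟨ cong₂ _+_ (*-identityˡ (f zero)) (sum-replicate-zero n) ⟩
  f zero + 0                 ≡⟨ +-identityʳ (f zero) ⟩
  f zero                     ∎
∑-δ {suc n} (suc a) f = ∑-δ a (f ∘ suc)

∑-scaled-δ : ∀ k (a : Fin n) (f : Fin n → ℕ) → ∑[ j < n ] (k * δ j a * f j) ≡ k * f a
∑-scaled-δ k a f = begin
  sum (λ j → k * δ j a * f j)    ≡⟨ sum-cong-≗ (λ j → *-assoc k (δ j a) (f j)) ⟩
  sum (λ j → k * (δ j a * f j))  ≡⟨ *-distribˡ-sum k (λ j → δ j a * f j) ⟨
  k * sum (λ j → δ j a * f j)    ≡⟨ cong (k *_) (∑-δ a f) ⟩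
  k * f a                        ∎

-- Reindexing along `π` reduces this to a plain delta sum. For `π` a translation of the loop it
-- expresses that an equation has exactly one solution.
∑-δ-permute : (π : Permutation′ n) (b : Fin n) → ∑[ k < n ] δ b (π ⟨$⟩ʳ k) ≡ 1
∑-δ-permute {n} π b = begin
  ∑[ k < n ] δ b (π ⟨$⟩ʳ k)  ≡⟨ ∑-permute (δ b) π ⟨
  ∑[ k < n ] δ b k           ≡⟨ sum-cong-≗ (λ k → trans (δ-sym b k) (sym (*-identityʳ (δ k b)))) ⟩
  ∑[ k < n ] (δ k b * 1)     ≡⟨ ∑-δ b (λ _ → 1) ⟩
  1                          ∎

∑-δ-permute-* : (π : Permutation′ n) (b : Fin n) → ∀ k → ∑[ y < n ] (δ b (π ⟨$⟩ʳ y) * k) ≡ k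
∑-δ-permute-* {n} π b k = begin
  ∑[ y < n ] (δ b (π ⟨$⟩ʳ y) * k)  ≡⟨ *-distribʳ-sum k (λ y → δ b (π ⟨$⟩ʳ y)) ⟨
  sum (λ y → δ b (π ⟨$⟩ʳ y)) * k   ≡⟨ cong (_* k) (∑-δ-permute π b) ⟩
  1 * k                            ≡⟨ *-identityˡ k ⟩
  k                                ∎

∑-++ : ∀ m (f : Fin (m + n) → ℕ) → sum f ≡ ∑[ i < m ] f (i ↑ˡ n) + ∑[ j < n ] f (m ↑ʳ j)
∑-++ zero    f = refl
∑-++ (suc m) f = trans (cong (f zero +_) (∑-++ m (f ∘ suc))) (sym (+-assoc (f zero) _ _))

∑-combine : ∀ m (f : Fin (m * n) → ℕ) → sum f ≡ ∑[ i < m ] ∑[ j < n ] f (combine i j)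
∑-combine zero    f = refl
∑-combine {n} (suc m) f =
  trans (∑-++ n f) (cong (∑[ j < n ] f (j ↑ˡ (m * n)) +_) (∑-combine m (f ∘ (n ↑ʳ_))))

∑-remQuot : ∀ m (f : Fin m × Fin n → ℕ) →
            ∑[ k < m * n ] f (remQuot n k) ≡ ∑[ i < m ] ∑[ j < n ] f (i , j)
∑-remQuot m f = trans (∑-combine m _)
  (sum-cong-≗ λ i → sum-cong-≗ λ j → cong f (remQuot-combine i j))

-- The bracketing is that of `B` below: one pair of lines for each layer.
∑-distrib-+₆ : (f₁ f₂ f₃ f₄ f₅ f₆ : Fin n → ℕ) →
  ∑[ k < n ] ((f₁ k + f₂ k) + ((f₃ k + f₄ k) + (f₅ k + f₆ k))) ≡
  (sum f₁ + sum f₂) + ((sum f₃ + sum f₄) + (sum f₅ + sum f₆))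
∑-distrib-+₆ f₁ f₂ f₃ f₄ f₅ f₆ =
  trans (∑-distrib-+ (λ k → f₁ k + f₂ k) _) (cong₂ _+_ (∑-distrib-+ f₁ f₂)
    (trans (∑-distrib-+ (λ k → f₃ k + f₄ k) _) (cong₂ _+_ (∑-distrib-+ f₃ f₄) (∑-distrib-+ f₅ f₆))))

-- `vertices` maps over `allFin`, which is `tabulate id`. The general `g` is what the induction
-- needs, since the tail tabulates `g ∘ suc`.
length-filter-tabulate : ∀ {A : Set} {P : Pred A _} (P? : Decidable P) (f : Fin m → A) (g : Fin n → Fin m) →
  length (filter P? (map f (tabulate g))) ≡ ∑[ k < n ] 𝟙 (P? (f (g k)))
length-filter-tabulate {n = zero}  P? f g = refl
length-filter-tabulate {n = suc n} P? f g with does (P? (f (g zero)))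
... | true  = cong suc (length-filter-tabulate P? f (g ∘ suc))
... | false = length-filter-tabulate P? f (g ∘ suc)

-- The three layers.

i≢i⁺ : ∀ i → i ≢ i ⁺
i≢i⁺ 0F ()
i≢i⁺ 1F ()
i≢i⁺ 2F ()

i≢i⁻ : ∀ i → i ≢ i ⁻
i≢i⁻ 0F ()
i≢i⁻ 1F ()
i≢i⁻ 2F ()

i⁺≢i⁻ : ∀ i → i ⁺ ≢ i ⁻
i⁺≢i⁻ 0F ()
i⁺≢i⁻ 1F ()
i⁺≢i⁻ 2F ()

-- The layers `i`, `i ⁺` and `i ⁻` exhaust `ℤ₃` without repetition. This trades layer-dependent
-- weights for constants, which is how the all-one matrix arises.
δ-layers : ∀ i j → δ j i + (δ j (i ⁺) + δ j (i ⁻)) ≡ 1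
δ-layers 0F 0F = refl
δ-layers 0F 1F = refl
δ-layers 0F 2F = refl
δ-layers 1F 0F = refl
δ-layers 1F 1F = refl
δ-layers 1F 2F = refl
δ-layers 2F 0F = refl
δ-layers 2F 1F = refl
δ-layers 2F 2F = refl

module _ {n : ℕ} {_∙_ _\\_ _//_ : Op₂ (Fin n)} {e : Fin n}
         (isLoop : IsLoop _≡_ _∙_ _\\_ _//_ e) {c : Fin n} (c≢e : c ≢ e) where

  private
    loop : Loop _ _
    loop = record { isLoop = isLoop }

  open IsLoop isLoop using (leftDividesˡ; leftDividesʳ; rightDividesˡ; rightDividesʳ)
  open LoopProperties loop using (identityˡ-unique; identityʳ-unique)

  open Digraph (Γ₄ _∙_ c)

  private
    V : Set
    V = Vertex₄ _∙_ c

  -- Sums over the vertex set.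

  opaque
    -- Opaque, so that outside this block vertex sums are handled through the lemmas below and never
    -- unfold into the enumeration.
    ∑ᵛ : (V → ℕ) → ℕ
    ∑ᵛ f = ∑[ k < order ] f (Inverse.from enum k)

    -- `Inverse.from enum` applies `remQuot` twice: the first application splits off `x`, the second
    -- separates `y` from `i`.
    ∑ᵛ-coordinates : (f : V → ℕ) → ∑ᵛ f ≡ ∑[ x < n ] ∑[ y < n ] ∑[ i < 3 ] f (x , y , i)
    ∑ᵛ-coordinates f =
      trans (∑-remQuot n (λ (x , k) → f (x , remQuot 3 k)))
            (sum-cong-≗ λ x → ∑-remQuot n (λ (y , i) → f (x , y , i)))

    ∑ᵛ-cong : {f g : V → ℕ} → (∀ v → f v ≡ g v) → ∑ᵛ f ≡ ∑ᵛ g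
    ∑ᵛ-cong {f} {g} f≗g =
      sum-cong-≗ {order} {f ∘ Inverse.from enum} {g ∘ Inverse.from enum} (f≗g ∘ Inverse.from enum)

    ∑ᵛ-distrib-+ : (f g : V → ℕ) → ∑ᵛ (λ v → f v + g v) ≡ ∑ᵛ f + ∑ᵛ g
    ∑ᵛ-distrib-+ f g = ∑-distrib-+ (f ∘ Inverse.from enum) (g ∘ Inverse.from enum)

    count≡∑ᵛ : {P : Pred V _} (P? : Decidable P) → count P? ≡ ∑ᵛ (λ v → 𝟙 (P? v))
    count≡∑ᵛ P? = length-filter-tabulate P? (Inverse.from enum) id

  ∑ᵛ-distrib-+₆ : (f₁ f₂ f₃ f₄ f₅ f₆ : V → ℕ) →
    ∑ᵛ (λ v → (f₁ v + f₂ v) + ((f₃ v + f₄ v) + (f₅ v + f₆ v))) ≡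
    (∑ᵛ f₁ + ∑ᵛ f₂) + ((∑ᵛ f₃ + ∑ᵛ f₄) + (∑ᵛ f₅ + ∑ᵛ f₆))
  ∑ᵛ-distrib-+₆ f₁ f₂ f₃ f₄ f₅ f₆ =
    trans (∑ᵛ-distrib-+ (λ v → f₁ v + f₂ v) _) (cong₂ _+_ (∑ᵛ-distrib-+ f₁ f₂)
      (trans (∑ᵛ-distrib-+ (λ v → f₃ v + f₄ v) _) (cong₂ _+_ (∑ᵛ-distrib-+ f₃ f₄) (∑ᵛ-distrib-+ f₅ f₆))))

  -- The adjacency matrix, the lines and `B`.

  A I B : V → V → ℕ
  A v w = 𝟙 (v ⟶? w)
  I (x , y , i) (x′ , y′ , j) = δ x′ x * (δ y′ y * δ j i)

  row col : Fin n → ℤ₃ → V → ℕ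
  row a i (x , y , j) = δ x a * δ j i
  col b i (x , y , j) = δ y b * δ j i

  B (x , y , i) w =
    (row x i w + col y i w) +
    ((row (x ∙ y) (i ⁺) w + row (c ∙ (x ∙ y)) (i ⁺) w) +
     (col (y ∙ x) (i ⁻) w + col ((y ∙ x) ∙ c) (i ⁻) w))

  -- Arcs inside a layer omit `x ≡ z` or `y ≡ z`; each copy of `I` puts the vertex back on one of
  -- its two lines. The arcs leaving the layer already fill four complete lines. No arc is of two of
  -- the six kinds, so the indicators add up.
  A+2I≡B : ∀ v w → A v w + 2 * I v w ≡ B v w
  A+2I≡B (x , y , i) (x′ , y′ , j) = begin
    𝟙 (C₁ ⊎-dec C₂ ⊎-dec C₃ ⊎-dec C₄ ⊎-dec C₅ ⊎-dec C₆) + 2 * (p * (q * s))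
      ≡⟨ cong (_+ 2 * (p * (q * s))) disjoint-sum ⟩
    𝟙 C₁ + (𝟙 C₂ + (𝟙 C₃ + (𝟙 C₄ + (𝟙 C₅ + 𝟙 C₆)))) + 2 * (p * (q * s))
      ≡⟨ cong (_+ 2 * (p * (q * s))) (cong₂ _+_ (𝟙-×₃ (¬? (x ≟ x′)) (y′ ≟ y) (j ≟ i))
        (cong₂ _+_ (𝟙-×₃ (¬? (y ≟ y′)) (x′ ≟ x) (j ≟ i))
        (cong₂ _+_ (𝟙-× (x′ ≟ x ∙ y) (j ≟ i ⁺)) (cong₂ _+_ (𝟙-× (y′ ≟ y ∙ x) (j ≟ i ⁻))
        (cong₂ _+_ (𝟙-× (x′ ≟ c ∙ (x ∙ y)) (j ≟ i ⁺)) (𝟙-× (y′ ≟ (y ∙ x) ∙ c) (j ≟ i ⁻))))))) ⟩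
    p̄ * (q * s) + (q̄ * (p * s) + (r₃ + (r₄ + (r₅ + r₆)))) + 2 * (p * (q * s))
      ≡⟨ regroup p q s p̄ q̄ r₃ r₄ r₅ r₆ ⟩
    ((q̄ + q) * (p * s) + (p̄ + p) * (q * s)) + ((r₃ + r₅) + (r₄ + r₆))
      ≡⟨ cong (_+ ((r₃ + r₅) + (r₄ + r₆))) (cong₂ _+_ (unit (p * s) (complement y y′)) (unit (q * s) (complement x x′))) ⟩
    (p * s + q * s) + ((r₃ + r₅) + (r₄ + r₆)) ∎
    where
    C₁ = ¬? (x ≟ x′) ×-dec (y′ ≟ y) ×-dec (j ≟ i)
    C₂ = ¬? (y ≟ y′) ×-dec (x′ ≟ x) ×-dec (j ≟ i)
    C₃ = (x′ ≟ x ∙ y) ×-dec (j ≟ i ⁺)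
    C₄ = (y′ ≟ y ∙ x) ×-dec (j ≟ i ⁻)
    C₅ = (x′ ≟ c ∙ (x ∙ y)) ×-dec (j ≟ i ⁺)
    C₆ = (y′ ≟ (y ∙ x) ∙ c) ×-dec (j ≟ i ⁻)
    p = δ x′ x
    q = δ y′ y
    s = δ j i
    p̄ = 𝟙 (¬? (x ≟ x′))
    q̄ = 𝟙 (¬? (y ≟ y′))
    r₃ = δ x′ (x ∙ y) * δ j (i ⁺)
    r₄ = δ y′ (y ∙ x) * δ j (i ⁻)
    r₅ = δ x′ (c ∙ (x ∙ y)) * δ j (i ⁺)
    r₆ = δ y′ ((y ∙ x) ∙ c) * δ j (i ⁻)

    𝟙-×₃ : {P Q R : Set} (P? : Dec P) (Q? : Dec Q) (R? : Dec R) →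
           𝟙 (P? ×-dec Q? ×-dec R?) ≡ 𝟙 P? * (𝟙 Q? * 𝟙 R?)
    𝟙-×₃ P? Q? R? = trans (𝟙-× P? (Q? ×-dec R?)) (cong (𝟙 P? *_) (𝟙-× Q? R?))

    regroup : ∀ p q s p̄ q̄ r₃ r₄ r₅ r₆ →
      p̄ * (q * s) + (q̄ * (p * s) + (r₃ + (r₄ + (r₅ + r₆)))) + 2 * (p * (q * s)) ≡
      ((q̄ + q) * (p * s) + (p̄ + p) * (q * s)) + ((r₃ + r₅) + (r₄ + r₆))
    regroup = solve-∀

    complement : (a b : Fin n) → 𝟙 (¬? (a ≟ b)) + δ b a ≡ 1
    complement a b = trans (cong (𝟙 (¬? (a ≟ b)) +_) (δ-sym b a)) (𝟙-¬ (a ≟ b))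

    unit : ∀ {k} l → k ≡ 1 → k * l ≡ l
    unit l refl = *-identityˡ l

    -- Kinds leading to different layers exclude each other. Within a layer, `C₁` keeps `y` while
    -- `C₂` changes it, and `c≢e` separates `C₃` from `C₅` and `C₄` from `C₆`.
    disjoint-sum : 𝟙 (C₁ ⊎-dec C₂ ⊎-dec C₃ ⊎-dec C₄ ⊎-dec C₅ ⊎-dec C₆) ≡
                   𝟙 C₁ + (𝟙 C₂ + (𝟙 C₃ + (𝟙 C₄ + (𝟙 C₅ + 𝟙 C₆))))
    disjoint-sum =
      trans (𝟙-⊎ C₁ (C₂ ⊎-dec C₃ ⊎-dec C₄ ⊎-dec C₅ ⊎-dec C₆) λ where
        (_ , y′≡y , _) (inj₁ (y≢y′ , _)) → y≢y′ (sym y′≡y)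
        (_ , _ , j≡i) (inj₂ other) → other-layer j≡i other) (cong (𝟙 C₁ +_)
      (trans (𝟙-⊎ C₂ (C₃ ⊎-dec C₄ ⊎-dec C₅ ⊎-dec C₆) λ (_ , _ , j≡i) → other-layer j≡i) (cong (𝟙 C₂ +_)
      (trans (𝟙-⊎ C₃ (C₄ ⊎-dec C₅ ⊎-dec C₆) λ where
        (_ , j≡i⁺) (inj₁ (_ , j≡i⁻)) → i⁺≢i⁻ i (trans (sym j≡i⁺) j≡i⁻)
        -- By cancellation, `c ∙ (x ∙ y) ≡ x ∙ y` would force `c ≡ e`.
        (xy , _) (inj₂ (inj₁ (cxy , _))) → c≢e (identityˡ-unique c (x ∙ y) (trans (sym cxy) xy))
        (_ , j≡i⁺) (inj₂ (inj₂ (_ , j≡i⁻))) → i⁺≢i⁻ i (trans (sym j≡i⁺) j≡i⁻)) (cong (𝟙 C₃ +_)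
      (trans (𝟙-⊎ C₄ (C₅ ⊎-dec C₆) λ where
        (_ , j≡i⁻) (inj₁ (_ , j≡i⁺)) → i⁺≢i⁻ i (trans (sym j≡i⁺) j≡i⁻)
        (yx , _) (inj₂ (yxc , _)) → c≢e (identityʳ-unique (y ∙ x) c (trans (sym yxc) yx))) (cong (𝟙 C₄ +_)
      (𝟙-⊎ C₅ C₆ λ (_ , j≡i⁺) (_ , j≡i⁻) → i⁺≢i⁻ i (trans (sym j≡i⁺) j≡i⁻)))))))))
      where
      other-layer : {P Q R S : Set} → j ≡ i →
        ¬ ((P × j ≡ i ⁺) ⊎ (Q × j ≡ i ⁻) ⊎ (R × j ≡ i ⁺) ⊎ (S × j ≡ i ⁻))
      other-layer refl (inj₁ (_ , i≡i⁺))                 = i≢i⁺ i i≡i⁺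
      other-layer refl (inj₂ (inj₁ (_ , i≡i⁻)))          = i≢i⁻ i i≡i⁻
      other-layer refl (inj₂ (inj₂ (inj₁ (_ , i≡i⁺))))   = i≢i⁺ i i≡i⁺
      other-layer refl (inj₂ (inj₂ (inj₂ (_ , i≡i⁻))))   = i≢i⁻ i i≡i⁻

  -- Sums weighted by a line or by the identity.

  ∑ᵛ-row : ∀ a i (f : V → ℕ) → ∑ᵛ (λ u → row a i u * f u) ≡ ∑[ y < n ] f (a , y , i)
  ∑ᵛ-row a i f = begin
    ∑ᵛ (λ u → row a i u * f u)
      ≡⟨ ∑ᵛ-coordinates _ ⟩
    ∑[ x < n ] ∑[ y < n ] ∑[ j < 3 ] (δ x a * δ j i * f (x , y , j))
      ≡⟨ (sum-cong-≗ λ x → sum-cong-≗ λ y → ∑-scaled-δ (δ x a) i (λ j → f (x , y , j))) ⟩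
    ∑[ x < n ] ∑[ y < n ] (δ x a * f (x , y , i))
      ≡⟨ (sum-cong-≗ λ x → *-distribˡ-sum (δ x a) (λ y → f (x , y , i))) ⟨
    ∑[ x < n ] (δ x a * (∑[ y < n ] f (x , y , i)))
      ≡⟨ ∑-δ a (λ x → ∑[ y < n ] f (x , y , i)) ⟩
    ∑[ y < n ] f (a , y , i) ∎

  ∑ᵛ-col : ∀ b i (f : V → ℕ) → ∑ᵛ (λ u → col b i u * f u) ≡ ∑[ x < n ] f (x , b , i)
  ∑ᵛ-col b i f = begin
    ∑ᵛ (λ u → col b i u * f u)
      ≡⟨ ∑ᵛ-coordinates _ ⟩
    ∑[ x < n ] ∑[ y < n ] ∑[ j < 3 ] (δ y b * δ j i * f (x , y , j))
      ≡⟨ (sum-cong-≗ λ x → sum-cong-≗ λ y → ∑-scaled-δ (δ y b) i (λ j → f (x , y , j))) ⟩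
    ∑[ x < n ] ∑[ y < n ] (δ y b * f (x , y , i))
      ≡⟨ (sum-cong-≗ λ x → ∑-δ b (λ y → f (x , y , i))) ⟩
    ∑[ x < n ] f (x , b , i) ∎

  ∑ᵛ-I : ∀ v (f : V → ℕ) → ∑ᵛ (λ u → I v u * f u) ≡ f v
  ∑ᵛ-I (x , y , i) f = begin
    ∑ᵛ (λ u → I (x , y , i) u * f u)
      -- `I` is the row through the vertex, cut down by the delta in the second coordinate, so that
      -- `∑ᵛ-row` applies.
      ≡⟨ ∑ᵛ-cong (λ (x′ , y′ , j) → rearrange′ (δ x′ x) (δ y′ y) (δ j i) (f (x′ , y′ , j))) ⟩
    ∑ᵛ (λ u → row x i u * (δ (proj₁ (proj₂ u)) y * f u))
      ≡⟨ ∑ᵛ-row x i (λ u → δ (proj₁ (proj₂ u)) y * f u) ⟩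
    ∑[ y′ < n ] (δ y′ y * f (x , y′ , i))
      ≡⟨ ∑-δ y (λ y′ → f (x , y′ , i)) ⟩
    f (x , y , i) ∎
    where
    rearrange′ : ∀ p q s k → p * (q * s) * k ≡ p * s * (q * k)
    rearrange′ = solve-∀

  I-sym : ∀ v w → I v w ≡ I w v
  I-sym (x , y , i) (x′ , y′ , j) = cong₂ _*_ (δ-sym x′ x) (cong₂ _*_ (δ-sym y′ y) (δ-sym j i))

  I-refl : ∀ v → I v v ≡ 1
  I-refl (x , y , i) = cong₂ _*_ (δ-refl x) (cong₂ _*_ (δ-refl y) (δ-refl i))

  I-distinct : ∀ v w → v ≢ w → I v w ≡ 0
  I-distinct (x , y , i) (x′ , y′ , j) v≢w = begin
    δ x′ x * (δ y′ y * δ j i)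
      ≡⟨ cong (δ x′ x *_) (𝟙-× (y′ ≟ y) (j ≟ i)) ⟨
    δ x′ x * 𝟙 ((y′ ≟ y) ×-dec (j ≟ i))
      ≡⟨ 𝟙-× (x′ ≟ x) ((y′ ≟ y) ×-dec (j ≟ i)) ⟨
    𝟙 ((x′ ≟ x) ×-dec (y′ ≟ y) ×-dec (j ≟ i))
      ≡⟨ 𝟙-false ((x′ ≟ x) ×-dec (y′ ≟ y) ×-dec (j ≟ i)) (λ { (refl , refl , refl) → v≢w refl }) ⟩
    0 ∎

  -- Translations and the sums of `B` over lines.

  private
    -- Left and right translations. The two divisions serve as their inverses, which is where unique
    -- solvability of equations enters.
    L R : Fin n → Permutation′ n
    L a = mk↔ₛ′ (a ∙_) (a \\_) (leftDividesˡ a) (leftDividesʳ a)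
    R a = mk↔ₛ′ (_∙ a) (_// a) (rightDividesˡ a) (rightDividesʳ a)

  -- δ j i stands on the left to avoid a truncated subtraction.
  ∑-B-row : ∀ a i w → (∑[ y < n ] B (a , y , i) w) + δ (proj₂ (proj₂ w)) i ≡ n * row a i w + 2
  ∑-B-row a i w@(x′ , y′ , j) = begin
    (∑[ y < n ] B (a , y , i) w) + δ j i
      ≡⟨ cong (_+ δ j i) (trans
           (∑-distrib-+₆ (λ y → row a i w) (λ y → col y i w)
             (λ y → row (a ∙ y) (i ⁺) w) (λ y → row (c ∙ (a ∙ y)) (i ⁺) w)
             (λ y → col (y ∙ a) (i ⁻) w) (λ y → col ((y ∙ a) ∙ c) (i ⁻) w))
           -- The first term does not depend on `y` and is counted `n` times. In each of the other
           -- five, `y` passes through the identity or through one or two translations, meets the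
           -- coordinate of `w` exactly once, and leaves the delta of the layer.
           (cong₂ _+_ (cong₂ _+_ (∑-const n (row a i w)) (∑-δ-permute-* idₚ y′ (δ j i)))
             (cong₂ _+_
               (cong₂ _+_ (∑-δ-permute-* (L a) x′ (δ j (i ⁺)))
                          (∑-δ-permute-* (L c ↔-∘ L a) x′ (δ j (i ⁺))))
               (cong₂ _+_ (∑-δ-permute-* (R a) y′ (δ j (i ⁻)))
                          (∑-δ-permute-* (R c ↔-∘ R a) y′ (δ j (i ⁻))))))) ⟩
    (n * row a i w + δ j i) + ((δ j (i ⁺) + δ j (i ⁺)) + (δ j (i ⁻) + δ j (i ⁻))) + δ j i
      -- The extra `δ j i` raises the weight of layer `i` from 1 to 2, the weight of the two other
      -- layers.
      ≡⟨ regroup (n * row a i w) (δ j i) (δ j (i ⁺)) (δ j (i ⁻)) ⟩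
    n * row a i w + 2 * (δ j i + (δ j (i ⁺) + δ j (i ⁻)))
      ≡⟨ cong (λ k → n * row a i w + 2 * k) (δ-layers i j) ⟩
    n * row a i w + 2 ∎
    where
    regroup : ∀ r s u d → (r + s) + ((u + u) + (d + d)) + s ≡ r + 2 * (s + (u + d))
    regroup = solve-∀

  -- The argument for rows with the varying coordinate exchanged: `x` now enters the products from
  -- the other side, so `R b` and `L b` take the places of `L a` and `R a`, while `L c` and `R c`
  -- stay.
  ∑-B-col : ∀ b i w → (∑[ x < n ] B (x , b , i) w) + δ (proj₂ (proj₂ w)) i ≡ n * col b i w + 2
  ∑-B-col b i w@(x′ , y′ , j) = begin
    (∑[ x < n ] B (x , b , i) w) + δ j i
      ≡⟨ cong (_+ δ j i) (trans
           (∑-distrib-+₆ (λ x → row x i w) (λ x → col b i w)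
             (λ x → row (x ∙ b) (i ⁺) w) (λ x → row (c ∙ (x ∙ b)) (i ⁺) w)
             (λ x → col (b ∙ x) (i ⁻) w) (λ x → col ((b ∙ x) ∙ c) (i ⁻) w))
           (cong₂ _+_ (cong₂ _+_ (∑-δ-permute-* idₚ x′ (δ j i)) (∑-const n (col b i w)))
             (cong₂ _+_
               (cong₂ _+_ (∑-δ-permute-* (R b) x′ (δ j (i ⁺)))
                          (∑-δ-permute-* (L c ↔-∘ R b) x′ (δ j (i ⁺))))
               (cong₂ _+_ (∑-δ-permute-* (L b) y′ (δ j (i ⁻)))
                          (∑-δ-permute-* (R c ↔-∘ L b) y′ (δ j (i ⁻))))))) ⟩
    (δ j i + n * col b i w) + ((δ j (i ⁺) + δ j (i ⁺)) + (δ j (i ⁻) + δ j (i ⁻))) + δ j i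
      ≡⟨ regroup (n * col b i w) (δ j i) (δ j (i ⁺)) (δ j (i ⁻)) ⟩
    n * col b i w + 2 * (δ j i + (δ j (i ⁺) + δ j (i ⁻)))
      ≡⟨ cong (λ k → n * col b i w + 2 * k) (δ-layers i j) ⟩
    n * col b i w + 2 ∎
    where
    regroup : ∀ r s u d → (s + r) + ((u + u) + (d + d)) + s ≡ r + 2 * (s + (u + d))
    regroup = solve-∀

  -- The squares of `B` and `A`.

  ∑ᵛ-B : ∀ x y i (f : V → ℕ) → ∑ᵛ (λ u → B (x , y , i) u * f u) ≡
    (∑[ z < n ] f (x , z , i) + ∑[ z < n ] f (z , y , i)) +
    ((∑[ z < n ] f (x ∙ y , z , i ⁺) + ∑[ z < n ] f (c ∙ (x ∙ y) , z , i ⁺)) +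
     (∑[ z < n ] f (z , y ∙ x , i ⁻) + ∑[ z < n ] f (z , (y ∙ x) ∙ c , i ⁻)))
  ∑ᵛ-B x y i f = begin
    ∑ᵛ (λ u → B (x , y , i) u * f u)
      ≡⟨ ∑ᵛ-cong (λ u → distrib (f u) (row x i u) (col y i u)
           (row (x ∙ y) (i ⁺) u) (row (c ∙ (x ∙ y)) (i ⁺) u)
           (col (y ∙ x) (i ⁻) u) (col ((y ∙ x) ∙ c) (i ⁻) u)) ⟩
    ∑ᵛ (λ u → (row x i u * f u + col y i u * f u) +
      ((row (x ∙ y) (i ⁺) u * f u + row (c ∙ (x ∙ y)) (i ⁺) u * f u) +
       (col (y ∙ x) (i ⁻) u * f u + col ((y ∙ x) ∙ c) (i ⁻) u * f u)))
      ≡⟨ ∑ᵛ-distrib-+₆ _ _ _ _ _ _ ⟩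
    (∑ᵛ (λ u → row x i u * f u) + ∑ᵛ (λ u → col y i u * f u)) +
    ((∑ᵛ (λ u → row (x ∙ y) (i ⁺) u * f u) + ∑ᵛ (λ u → row (c ∙ (x ∙ y)) (i ⁺) u * f u)) +
     (∑ᵛ (λ u → col (y ∙ x) (i ⁻) u * f u) + ∑ᵛ (λ u → col ((y ∙ x) ∙ c) (i ⁻) u * f u)))
      ≡⟨ cong₂ _+_ (cong₂ _+_ (∑ᵛ-row x i f) (∑ᵛ-col y i f))
           (cong₂ _+_
             (cong₂ _+_ (∑ᵛ-row (x ∙ y) (i ⁺) f) (∑ᵛ-row (c ∙ (x ∙ y)) (i ⁺) f))
             (cong₂ _+_ (∑ᵛ-col (y ∙ x) (i ⁻) f) (∑ᵛ-col ((y ∙ x) ∙ c) (i ⁻) f))) ⟩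
    _ ∎
    where
    distrib : ∀ k a₁ a₂ a₃ a₄ a₅ a₆ →
      ((a₁ + a₂) + ((a₃ + a₄) + (a₅ + a₆))) * k ≡
      (a₁ * k + a₂ * k) + ((a₃ * k + a₄ * k) + (a₅ * k + a₆ * k))
    distrib = solve-∀

  -- Row `v` of `B` consists of six lines, and each of them contributes `n` times itself, plus 2,
  -- minus the delta of its layer. Every layer holds two of the lines, so the deltas add up to 2 and
  -- the constant is 12 - 2 = 10.
  B²≡nB+10J : ∀ v w → ∑ᵛ (λ u → B v u * B u w) ≡ n * B v w + 10
  B²≡nB+10J v@(x , y , i) w@(_ , _ , j) =
    +-cancelʳ-≡ 2 _ _ (begin
      ∑ᵛ (λ u → B v u * B u w) + 2
        -- The added 2 is twice the sum of the layer deltas, which supplies one delta to each of the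
        -- six line sums.
        ≡⟨ cong₂ _+_ (∑ᵛ-B x y i (λ u → B u w)) (cong (2 *_) (sym (δ-layers i j))) ⟩
      (s₁ + s₂) + ((s₃ + s₄) + (s₅ + s₆)) + 2 * (δ j i + (δ j (i ⁺) + δ j (i ⁻)))
        ≡⟨ pair s₁ s₂ s₃ s₄ s₅ s₆ (δ j i) (δ j (i ⁺)) (δ j (i ⁻)) ⟩
      ((s₁ + δ j i) + (s₂ + δ j i)) +
      (((s₃ + δ j (i ⁺)) + (s₄ + δ j (i ⁺))) + ((s₅ + δ j (i ⁻)) + (s₆ + δ j (i ⁻))))
        ≡⟨ cong₂ _+_ (cong₂ _+_ (∑-B-row x i w) (∑-B-col y i w))
             (cong₂ _+_
               (cong₂ _+_ (∑-B-row (x ∙ y) (i ⁺) w) (∑-B-row (c ∙ (x ∙ y)) (i ⁺) w))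
               (cong₂ _+_ (∑-B-col (y ∙ x) (i ⁻) w) (∑-B-col ((y ∙ x) ∙ c) (i ⁻) w))) ⟩
      _ ≡⟨ collect n (row x i w) (col y i w)
             (row (x ∙ y) (i ⁺) w) (row (c ∙ (x ∙ y)) (i ⁺) w)
             (col (y ∙ x) (i ⁻) w) (col ((y ∙ x) ∙ c) (i ⁻) w) ⟩
      n * B v w + 10 + 2 ∎)
    where
    s₁ = ∑[ z < n ] B (x , z , i) w
    s₂ = ∑[ z < n ] B (z , y , i) w
    s₃ = ∑[ z < n ] B (x ∙ y , z , i ⁺) w
    s₄ = ∑[ z < n ] B (c ∙ (x ∙ y) , z , i ⁺) w
    s₅ = ∑[ z < n ] B (z , y ∙ x , i ⁻) w
    s₆ = ∑[ z < n ] B (z , (y ∙ x) ∙ c , i ⁻) w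

    pair : ∀ s₁ s₂ s₃ s₄ s₅ s₆ s u d →
      (s₁ + s₂) + ((s₃ + s₄) + (s₅ + s₆)) + 2 * (s + (u + d)) ≡
      ((s₁ + s) + (s₂ + s)) + (((s₃ + u) + (s₄ + u)) + ((s₅ + d) + (s₆ + d)))
    pair = solve-∀

    collect : ∀ n a₁ a₂ a₃ a₄ a₅ a₆ →
      ((n * a₁ + 2) + (n * a₂ + 2)) +
      (((n * a₃ + 2) + (n * a₄ + 2)) + ((n * a₅ + 2) + (n * a₆ + 2))) ≡
      n * ((a₁ + a₂) + ((a₃ + a₄) + (a₅ + a₆))) + 10 + 2
    collect = solve-∀

  A² : V → V → ℕ
  A² v w = ∑ᵛ (λ u → A v u * A u w)

  -- Expands the square of `A` + 2`I` in `B²≡nB+10J`, keeping every term additive.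
  A²-identity : ∀ v w → A² v w + (4 * A v w + 4 * I v w) ≡ n * (A v w + 2 * I v w) + 10
  A²-identity v w = begin
    A² v w + (4 * A v w + 4 * I v w)
      ≡⟨ split (A² v w) (A v w) (I v w) ⟩
    A² v w + ((2 * A v w + 2 * A v w) + 4 * I v w)
      -- The two halves of `4 * A v w` are the products of 2`I` with `A` from the left and from the
      -- right. The right-hand product is written with `I w u` in front so that `∑ᵛ-I` applies;
      -- `I-sym` turns it into `I u w` further down.
      ≡⟨ cong (A² v w +_) (cong₂ _+_ (cong₂ _+_
           (∑ᵛ-I v (λ u → 2 * A u w)) (∑ᵛ-I w (λ u → 2 * A v u))) (∑ᵛ-I v (λ u → 4 * I u w))) ⟨
    A² v w + ((∑ᵛ (λ u → I v u * (2 * A u w)) + ∑ᵛ (λ u → I w u * (2 * A v u)))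
                + ∑ᵛ (λ u → I v u * (4 * I u w)))
      ≡⟨ cong (A² v w +_) (cong (_+ ∑ᵛ (λ u → I v u * (4 * I u w))) (∑ᵛ-distrib-+ _ _)) ⟨
    A² v w + (∑ᵛ (λ u → I v u * (2 * A u w) + I w u * (2 * A v u))
                + ∑ᵛ (λ u → I v u * (4 * I u w)))
      ≡⟨ cong (A² v w +_) (∑ᵛ-distrib-+ _ _) ⟨
    A² v w + ∑ᵛ (λ u → I v u * (2 * A u w) + I w u * (2 * A v u) + I v u * (4 * I u w))
      ≡⟨ ∑ᵛ-distrib-+ _ _ ⟨
    ∑ᵛ (λ u → A v u * A u w + (I v u * (2 * A u w) + I w u * (2 * A v u) + I v u * (4 * I u w)))
      ≡⟨ ∑ᵛ-cong (λ u → trans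
           (cong (λ k → A v u * A u w + (I v u * (2 * A u w) + k * (2 * A v u) + I v u * (4 * I u w))) (I-sym w u))
           (trans (expand (A v u) (A u w) (I v u) (I u w)) (cong₂ _*_ (A+2I≡B v u) (A+2I≡B u w)))) ⟩
    ∑ᵛ (λ u → B v u * B u w)
      ≡⟨ B²≡nB+10J v w ⟩
    n * B v w + 10
      ≡⟨ cong (λ k → n * k + 10) (A+2I≡B v w) ⟨
    n * (A v w + 2 * I v w) + 10 ∎
    where
    split : ∀ k a i → k + (4 * a + 4 * i) ≡ k + ((2 * a + 2 * a) + 4 * i)
    split = solve-∀

    expand : ∀ a a′ i i′ → a * a′ + (i * (2 * a′) + i′ * (2 * a) + i * (4 * i′)) ≡ (a + 2 * i) * (a′ + 2 * i′)
    expand = solve-∀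

  -- Out-degrees and in-degrees.

  ∑ᵛ-B-out : ∀ v → ∑ᵛ (B v) ≡ 6 * n
  ∑ᵛ-B-out v@(x , y , i) = begin
    ∑ᵛ (B v)
      ≡⟨ ∑ᵛ-cong (λ u → *-identityʳ (B v u)) ⟨
    ∑ᵛ (λ u → B v u * 1)
      ≡⟨ ∑ᵛ-B x y i (λ _ → 1) ⟩
    -- Against the constant 1, each of the six line sums counts the `n` points of a line.
    _ ≡⟨ cong (λ k → (k + k) + ((k + k) + (k + k))) (trans (∑-const n 1) (*-identityʳ n)) ⟩
    (n + n) + ((n + n) + (n + n))
      ≡⟨ six n ⟩
    6 * n ∎
    where
    six : ∀ n → (n + n) + ((n + n) + (n + n)) ≡ 6 * n
    six = solve-∀

  -- Columns of `B` are not given as unions of lines, so the vertex set is cut into its `3 * n` rows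
  -- and `∑-B-row` is summed over them. The row indicators contribute `n`, the constants `6 * n`,
  -- and the deltas, one for each `x`, take `n` away again.
  ∑ᵛ-B-in : ∀ w → ∑ᵛ (λ u → B u w) ≡ 6 * n
  ∑ᵛ-B-in w@(x′ , y′ , j) = trans (∑ᵛ-coordinates _) (+-cancelʳ-≡ n _ _ (begin
    (∑[ x < n ] ∑[ y < n ] ∑[ i < 3 ] B (x , y , i) w) + n
      ≡⟨ cong₂ _+_ (sum-cong-≗ λ x → ∑-comm (λ y i → B (x , y , i) w))
                   (sym (trans (∑-const n 1) (*-identityʳ n))) ⟩
    (∑[ x < n ] ∑[ i < 3 ] ∑[ y < n ] B (x , y , i) w) + ∑[ x < n ] 1
      ≡⟨ ∑-distrib-+ (λ x → ∑[ i < 3 ] ∑[ y < n ] B (x , y , i) w) (λ _ → 1) ⟨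
    ∑[ x < n ] ((∑[ i < 3 ] ∑[ y < n ] B (x , y , i) w) + 1)
      ≡⟨ sum-cong-≗ (λ x → ∑-layers (δ x′ x) (δ j) (λ i → ∑[ y < n ] B (x , y , i) w)
           (∑-δ-permute idₚ j) (λ i → ∑-B-row x i w)) ⟩
    ∑[ x < n ] (δ x′ x * n + 6)
      ≡⟨ ∑-distrib-+ (λ x → δ x′ x * n) (λ _ → 6) ⟩
    ∑[ x < n ] (δ x′ x * n) + ∑[ x < n ] 6
      ≡⟨ cong₂ _+_ (∑-δ-permute-* idₚ x′ n) (∑-const n 6) ⟩
    n + n * 6
      ≡⟨ trans (+-comm n (n * 6)) (cong (_+ n) (*-comm n 6)) ⟩
    6 * n + n ∎))
    where
    -- Applied with `m` = 3 and `s` the layer delta of `w`; the 6 in the sum over `x` is `3 * 2`.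
    ∑-layers : ∀ {m} p (s f : Fin m → ℕ) → sum s ≡ 1 → (∀ i → f i + s i ≡ n * (p * s i) + 2) →
               sum f + 1 ≡ p * n + m * 2
    ∑-layers {m} p s f ∑s≡1 f+s = begin
      sum f + 1                                  ≡⟨ cong (sum f +_) ∑s≡1 ⟨
      sum f + sum s                              ≡⟨ ∑-distrib-+ f s ⟨
      ∑[ i < m ] (f i + s i)                     ≡⟨ sum-cong-≗ (λ i → trans (f+s i) (cong (_+ 2) (swap n p (s i)))) ⟩
      ∑[ i < m ] (p * n * s i + 2)               ≡⟨ ∑-distrib-+ (λ i → p * n * s i) (λ _ → 2) ⟩
      ∑[ i < m ] (p * n * s i) + ∑[ i < m ] 2    ≡⟨ cong₂ _+_ (sym (*-distribˡ-sum (p * n) s)) (∑-const m 2) ⟩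
      p * n * sum s + m * 2                      ≡⟨ cong (_+ m * 2) (trans (cong (p * n *_) ∑s≡1) (*-identityʳ (p * n))) ⟩
      p * n + m * 2                              ∎
      where
      swap : ∀ n p s → n * (p * s) ≡ p * n * s
      swap = solve-∀

  ∑ᵛ-2I : ∀ v → ∑ᵛ (λ u → 2 * I v u) ≡ 2
  ∑ᵛ-2I v = trans (∑ᵛ-cong (λ u → *-comm 2 (I v u))) (∑ᵛ-I v (λ _ → 2))

  -- Adding the row sum 2 of 2`I` first makes the truncated subtraction exact.
  ∑ᵛ-A-out : ∀ v → ∑ᵛ (A v) ≡ 6 * n ∸ 2
  ∑ᵛ-A-out v = begin
    ∑ᵛ (A v)                               ≡⟨ m+n∸n≡m (∑ᵛ (A v)) 2 ⟨
    ∑ᵛ (A v) + 2 ∸ 2                       ≡⟨ cong (λ k → ∑ᵛ (A v) + k ∸ 2) (∑ᵛ-2I v) ⟨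
    ∑ᵛ (A v) + ∑ᵛ (λ u → 2 * I v u) ∸ 2    ≡⟨ cong (_∸ 2) (∑ᵛ-distrib-+ (A v) _) ⟨
    ∑ᵛ (λ u → A v u + 2 * I v u) ∸ 2       ≡⟨ cong (_∸ 2) (∑ᵛ-cong (A+2I≡B v)) ⟩
    ∑ᵛ (B v) ∸ 2                           ≡⟨ cong (_∸ 2) (∑ᵛ-B-out v) ⟩
    6 * n ∸ 2                              ∎

  ∑ᵛ-A-in : ∀ w → ∑ᵛ (λ u → A u w) ≡ 6 * n ∸ 2
  ∑ᵛ-A-in w = begin
    ∑ᵛ A·w                               ≡⟨ m+n∸n≡m (∑ᵛ A·w) 2 ⟨
    ∑ᵛ A·w + 2 ∸ 2                       ≡⟨ cong (λ k → ∑ᵛ A·w + k ∸ 2) (∑ᵛ-2I w) ⟨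
    ∑ᵛ A·w + ∑ᵛ (λ u → 2 * I w u) ∸ 2    ≡⟨ cong (_∸ 2) (∑ᵛ-distrib-+ A·w _) ⟨
    ∑ᵛ (λ u → A u w + 2 * I w u) ∸ 2
      ≡⟨ cong (_∸ 2) (∑ᵛ-cong λ u → trans (cong (λ k → A u w + 2 * k) (I-sym w u)) (A+2I≡B u w)) ⟩
    ∑ᵛ (λ u → B u w) ∸ 2                 ≡⟨ cong (_∸ 2) (∑ᵛ-B-in w) ⟩
    6 * n ∸ 2                            ∎
    where
    A·w : V → ℕ
    A·w u = A u w

  -- Reading off the parameters.

  count-paths : ∀ v w → count (λ u → (v ⟶? u) ×-dec (u ⟶? w)) ≡ A² v w
  count-paths v w = trans (count≡∑ᵛ (λ u → (v ⟶? u) ×-dec (u ⟶? w)))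
                          (∑ᵛ-cong λ u → 𝟙-× (v ⟶? u) (u ⟶? w))

  arc⇒distinct : ∀ {v w} → v ⟶ w → v ≢ w
  arc⇒distinct (change-fst x≢z) eq = x≢z (cong proj₁ eq)
  arc⇒distinct (change-snd y≢z) eq = y≢z (cong (proj₁ ∘ proj₂) eq)
  arc⇒distinct up               eq = i≢i⁺ _ (cong (proj₂ ∘ proj₂) eq)
  arc⇒distinct down             eq = i≢i⁻ _ (cong (proj₂ ∘ proj₂) eq)
  arc⇒distinct up-c             eq = i≢i⁺ _ (cong (proj₂ ∘ proj₂) eq)
  arc⇒distinct down-c           eq = i≢i⁻ _ (cong (proj₂ ∘ proj₂) eq)

  -- With the entries of `A` and `I` replaced by numerals, the matrix identity becomes arithmetic in
  -- `n`.
  A²-value : ∀ v w {a i} → A v w ≡ a → I v w ≡ i →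
             A² v w + (4 * a + 4 * i) ≡ n * (a + 2 * i) + 10
  A²-value v w refl refl = A²-identity v w

  isDSRG : IsDSRG (Γ₄ _∙_ c) (3 * n ^ 2) (6 * n ∸ 2) (2 * n + 6) (n + 6) 10
  isDSRG = record
    { order≡N            = size n
    ; loopless           = λ v v⟶v → arc⇒distinct v⟶v refl
    ; outDegree≡k        = λ v → trans (count≡∑ᵛ (λ u → v ⟶? u)) (∑ᵛ-A-out v)
    ; inDegree≡k         = λ v → trans (count≡∑ᵛ (λ u → u ⟶? v)) (∑ᵛ-A-in v)
    -- Undirected edges at `v` are counted as closed paths of length 2, a diagonal entry of `A²`.
    -- The pair (`a`, `i`) is (0, 1) here, (1, 0) on arcs and (0, 0) otherwise, so `4 * a + 4 * i`,
    -- the summand cancelled, is 4, 4 and 0.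
    ; undirectedDegree≡t = λ v → trans (count-paths v v) (+-cancelʳ-≡ 4 _ _ (trans
        (A²-value v v (𝟙-false (v ⟶? v) λ v⟶v → arc⇒distinct v⟶v refl) (I-refl v)) (diagonal n)))
    ; adjacent           = λ v w v≢w v⟶w → trans (count-paths v w) (+-cancelʳ-≡ 4 _ _ (trans
        (A²-value v w (𝟙-true (v ⟶? w) v⟶w) (I-distinct v w v≢w)) (on-arcs n)))
    ; nonadjacent        = λ v w v≢w ¬v⟶w → trans (count-paths v w) (+-cancelʳ-≡ 0 _ _ (trans
        (A²-value v w (𝟙-false (v ⟶? w) ¬v⟶w) (I-distinct v w v≢w)) (off-arcs n)))
    }
    where
    size : ∀ n → n * (n * 3) ≡ 3 * (n * (n * 1))
    size = solve-∀

    diagonal : ∀ n → n * 2 + 10 ≡ 2 * n + 6 + 4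
    diagonal = solve-∀

    on-arcs : ∀ n → n * 1 + 10 ≡ n + 6 + 4
    on-arcs = solve-∀

    off-arcs : ∀ n → n * 0 + 10 ≡ 10
    off-arcs = solve-∀

theorem5p2 : (n : ℕ) (_∙_ _\\_ _//_ : Op₂ (Fin n)) (e : Fin n) →
    IsLoop _≡_ _∙_ _\\_ _//_ e →
    (c : Fin n) → c ≢ e →
    IsDSRG (Γ₄ _∙_ c) (3 * n ^ 2) (6 * n ∸ 2) (2 * n + 6) (n + 6) 10
theorem5p2 n _∙_ _\\_ _//_ e isLoop c c≢e = isDSRG isLoop c≢e
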